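{- For every integer $k \ge 1$, the edge set of the hypercube $Q_{2k+1}$ can be partitioned into the edge sets of $k$ pairwise edge-disjoint spanning trees of $Q_{2k+1}$ together with a set $R$ of remaining edges such that the graph formed by $R$ (with vertex set the set of endpoints of edges of $R$) is a forest with exactly $k$ connected components.
   Context: The $n$-dimensional hypercube $Q_n$ is the graph whose vertices are all binary vectors of length $n$, with two vertices adjacent if and only if they differ in exactly one coordinate. A forest is an acyclic graph. -}

module Defs where

open import Data.Bool.Base using (Bool)
open import Data.Fin.Base using (Fin; zero; suc; inject₁; fromℕ)
open import Data.Nat.Base using (ℕ; _+_)
open import Data.Product using (Σ; ∃; ∃-syntax; ∃!; _×_; _,_; proj₁)
open import Data.Sum.Base using (_⊎_)
open import Data.Vec.Base using (Vec; lookup)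
open import Function.Bundles using (Bijection)
open import Function.Definitions using (Injective)
open import Level using (0ℓ)
open import Relation.Binary.Bundles using (Setoid)
open import Relation.Binary.Construct.Closure.ReflexiveTransitive using (Star; ε; _◅◅_; reverse)
open import Relation.Binary.Core using (Rel; _⇒_)
open import Relation.Binary.Definitions using (Symmetric; Irreflexive)
open import Relation.Binary.PropositionalEquality using (_≡_; _≢_; refl; sym; setoid)
open import Relation.Nullary using (¬_)
open import Relation.Unary using (Pred; U; _⊆_; Satisfiable)

-- A simple graph whose vertices are the elements of V satisfying Vertex.
-- The ambient type V is shared by a graph and all of its subgraphs.  The edge
-- {u , v} is present when Adj u v is inhabited; distinct proofs of Adj u v are
-- not parallel edges.
record Graph (V : Set) : Set₁ where
  field
    Vertex       : Pred V 0ℓ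
    Adj          : Rel V 0ℓ
    adj-sym      : Symmetric Adj
    adj-irrefl   : Irreflexive _≡_ Adj
    adj⇒vertex   : ∀ {u v} → Adj u v → Vertex u

open Graph public

hypercube : ∀ n → Graph (Vec Bool n)
hypercube n = record
  { Vertex     = U
  ; Adj        = λ u v → ∃! _≡_ (λ i → lookup u i ≢ lookup v i)
  ; adj-sym    = λ (i , u≢v , unique) →
                   i , (λ eq → u≢v (sym eq)) , λ v≢u → unique (λ eq → v≢u (sym eq))
  ; adj-irrefl = λ { refl (_ , u≢u , _) → u≢u refl }
  ; adj⇒vertex = _
  }

module _ {V : Set} where

  record IsSubgraph (H G : Graph V) : Set where
    field
      vertices : Vertex H ⊆ Vertex G
      edges    : Adj H ⇒ Adj G

  Walk : Graph V → Rel V 0ℓ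
  Walk G = Star (Adj G)

  Connected : Graph V → Set
  Connected G = Satisfiable (Vertex G) ×
    (∀ {u v} → Vertex G u → Vertex G v → Walk G u v)

  record Cycle (G : Graph V) : Set where
    field
      m        : ℕ
      vertex   : Fin (3 + m) → V
      distinct : Injective _≡_ _≡_ vertex
      step     : ∀ (i : Fin (2 + m)) → Adj G (vertex (inject₁ i)) (vertex (suc i))
      close    : Adj G (vertex (fromℕ (2 + m))) (vertex zero)

  IsForest : Graph V → Set
  IsForest G = ¬ Cycle G

  IsTree : Graph V → Set
  IsTree G = Connected G × IsForest G

  record IsSpanningTree (G T : Graph V) : Set where
    field
      subgraph : IsSubgraph T G
      spanning : Vertex G ⊆ Vertex T
      tree     : IsTree T

  -- The set of connected components, i.e. the quotient of the vertex set by
  -- "joined by a walk".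
  Components : Graph V → Setoid 0ℓ 0ℓ
  Components G = record
    { Carrier       = Σ V (Vertex G)
    ; _≈_           = λ u v → Walk G (proj₁ u) (proj₁ v)
    ; isEquivalence = record
      { refl  = ε
      ; sym   = reverse (adj-sym G)
      ; trans = _◅◅_
      }
    }

  HasComponents : Graph V → ℕ → Set
  HasComponents G k = Bijection (Components G) (setoid (Fin k))

  record EdgeSet (G : Graph V) : Set₁ where
    field
      Edge     : Rel V 0ℓ
      edge-sym : Symmetric Edge
      edge⇒adj : Edge ⇒ Adj G

  open EdgeSet public

  edgeInduced : {G : Graph V} → EdgeSet G → Graph V
  edgeInduced {G} R = record
    { Vertex     = λ u → ∃[ v ] Edge R u v
    ; Adj        = Edge R
    ; adj-sym    = edge-sym R
    ; adj-irrefl = λ u≡v e → adj-irrefl G u≡v (edge⇒adj R e)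
    ; adj⇒vertex = λ e → _ , e
    }

  record IsEdgePartition (G : Graph V) {k : ℕ} (T : Fin k → Graph V) (R : EdgeSet G) : Set where
    field
      subgraphs      : ∀ i → IsSubgraph (T i) G
      covers         : ∀ {u v} → Adj G u v → (∃[ i ] Adj (T i) u v) ⊎ Edge R u v
      edge-disjoint  : ∀ {i j} → i ≢ j → ∀ {u v} → Adj (T i) u v → ¬ Adj (T j) u v
      rest-disjoint  : ∀ {i u v} → Adj (T i) u v → ¬ Edge R u v

{-# OPTIONS --safe #-}
module Submission where

open import Defs
open import Data.Bool.Base using (Bool; true; false; not; _∧_; _xor_; if_then_else_)
open import Data.Bool.Properties using (xor-same) renaming (_≟_ to _≟ᴮ_)
open import Data.Empty using (⊥)
open import Data.Fin.Base using (Fin; zero; suc; inject₁; fromℕ)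
open import Data.Fin.Properties using (suc-injective) renaming (_≟_ to _≟ᶠ_)
open import Data.Nat.Base using (ℕ; zero; suc; _+_; _*_; _≥_)
open import Data.Nat.Properties using (+-comm; *-comm)
open import Data.Product using (Σ-syntax; ∃-syntax; _×_; _,_; proj₁; proj₂)
open import Data.Sum.Base as Sum using (_⊎_; inj₁; inj₂)
open import Data.Sum.Properties using (inj₁-injective)
open import Data.Unit.Base using (⊤; tt)
open import Data.Vec.Base using (Vec; []; _∷_; lookup; head; tail)
open import Data.Vec.Properties using (≡-dec; ∷-injective; tabulate∘lookup; tabulate-cong)
open import Function.Base using (_∘_; id; const)
open import Relation.Binary.Construct.Closure.ReflexiveTransitive
  using (Star; ε; _◅_; _◅◅_; gmap; reverse)
open import Relation.Binary.Core using (Rel; _⇒_)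
open import Relation.Binary.Definitions using (DecidableEquality)
open import Relation.Binary.PropositionalEquality
  using (_≡_; _≢_; _≗_; refl; sym; trans; cong; cong₂; subst; subst₂)
open import Relation.Nullary using (¬_; yes; no; does; contradiction)
open import Relation.Nullary.Decidable using (dec-true; dec-false; decidable-stable)
open import Relation.Unary using (U)

-- By induction Q₂ₖ is the union of k spanning trees T₀, …, Tₖ₋₁ and a matching of
-- k edges vⱼwⱼ.  Let Qₙ₊₂ = Qₙ □ C₄ consist of copies 0, 1, 2, 3 of Qₙ.  A new
-- spanning tree takes T₀ in copy 0 and hangs every other vertex on its neighbour in
-- the previous copy, except that some vⱼ hang on wⱼ inside their copy; this frees
-- the cross edges at these vⱼ, with which the copies of Tⱼ are linked.  For j = 0
-- these are only the copies 1, 2 and 3, and copy 0 hangs on copy 3 instead.  What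
-- remains is the matching of copy 0 and the edge v₀w₀ in copy 1.
--
-- For Q₂ₖ₊₁ take two copies: T₀ in the first carries the second one in the same way,
-- each Tⱼ with j > 0 is linked at vⱼ, and the remainder is the matching of the first
-- copy together with T₀ in the second, joined by the cross edge at v₀.

private variable
  n k : ℕ
  A : Set

-- Edges of the cube, oriented upwards

data CubeEdge : ℕ → Set where
  flip : Vec Bool n → CubeEdge (suc n)
  keep : Bool → CubeEdge n → CubeEdge (suc n)

src tgt : CubeEdge n → Vec Bool n
src (flip x)   = false ∷ x
src (keep b e) = b ∷ src e
tgt (flip x)   = true ∷ x
tgt (keep b e) = b ∷ tgt e

_≟_ : DecidableEquality (Vec Bool n)
_≟_ = ≡-dec _≟ᴮ_

src≢tgt : (e : CubeEdge n) → src e ≢ tgt e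
src≢tgt (keep b e) eq = src≢tgt e (proj₂ (∷-injective eq))

Joins : CubeEdge n → Rel (Vec Bool n) _
Joins e u v = (src e ≡ u × tgt e ≡ v) ⊎ (src e ≡ v × tgt e ≡ u)

Joins-sym : {e : CubeEdge n} {u v : Vec Bool n} → Joins e u v → Joins e v u
Joins-sym (inj₁ p) = inj₂ p
Joins-sym (inj₂ p) = inj₁ p

same-ends⇒≡ : (e e′ : CubeEdge n) → src e ≡ src e′ → tgt e ≡ tgt e′ → e ≡ e′
same-ends⇒≡ (flip x) (flip y) p q = cong flip (cong tail p)
same-ends⇒≡ (flip x) (keep b e′) p q with () ← trans (cong head p) (sym (cong head q))
same-ends⇒≡ (keep b e) (flip y) p q with () ← trans (sym (cong head p)) (cong head q)
same-ends⇒≡ (keep b e) (keep c e′) p q with refl ← cong head p =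
  cong (keep b) (same-ends⇒≡ e e′ (cong tail p) (cong tail q))

-- Each edge raises one coordinate from `false` to `true` and fixes the others, so its ends
-- determine its direction. A `flip` settles the matter at the head; two `keep`s pass to the tails.
no-antiparallel : (e e′ : CubeEdge n) → src e ≡ tgt e′ → tgt e ≢ src e′
no-antiparallel (flip x) (flip y) p q with () ← cong head p
no-antiparallel (flip x) (keep b e′) p q with () ← trans (cong head p) (sym (cong head q))
no-antiparallel (keep b e) (flip y) p q with () ← trans (sym (cong head p)) (cong head q)
no-antiparallel (keep b e) (keep c e′) p q = no-antiparallel e e′ (cong tail p) (cong tail q)

-- This turns any colouring of `CubeEdge n` into pairwise disjoint sets of adjacent pairs.
Joins-unique : {e e′ : CubeEdge n} {u v : Vec Bool n} → Joins e u v → Joins e′ u v → e ≡ e′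
Joins-unique (inj₁ (refl , refl)) (inj₁ (p , q)) = same-ends⇒≡ _ _ (sym p) (sym q)
Joins-unique (inj₁ (refl , refl)) (inj₂ (p , q)) =
  contradiction p (no-antiparallel _ _ (sym q) ∘ sym)
Joins-unique (inj₂ (refl , refl)) (inj₁ (p , q)) =
  contradiction p (no-antiparallel _ _ (sym q) ∘ sym)
Joins-unique (inj₂ (refl , refl)) (inj₂ (p , q)) = same-ends⇒≡ _ _ (sym p) (sym q)

Adj-ends : (e : CubeEdge n) → Adj (hypercube n) (src e) (tgt e)
Adj-ends (flip x) = zero , (λ ()) , unique
  where
  unique : ∀ {j} → lookup (false ∷ x) j ≢ lookup (true ∷ x) j → zero ≡ j
  unique {zero}  _  = refl
  unique {suc j} ≢ⱼ = contradiction refl ≢ⱼ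
Adj-ends (keep b e) = let i , ≢ᵢ , unique = Adj-ends e in suc i , ≢ᵢ , unique-suc unique
  where
  unique-suc : ∀ {i} → (∀ {j} → lookup (src e) j ≢ lookup (tgt e) j → i ≡ j) →
    ∀ {j} → lookup (b ∷ src e) j ≢ lookup (b ∷ tgt e) j → suc i ≡ j
  unique-suc unique {zero}  b≢b = contradiction refl b≢b
  unique-suc unique {suc j} ≢ⱼ  = cong suc (unique ≢ⱼ)

Joins⇒Adj : {e : CubeEdge n} {u v : Vec Bool n} → Joins e u v → Adj (hypercube n) u v
Joins⇒Adj {e = e} (inj₁ (refl , refl)) = Adj-ends e
Joins⇒Adj {e = e} (inj₂ (refl , refl)) = adj-sym (hypercube _) {src e} {tgt e} (Adj-ends e)

lookup-ext : {u v : Vec A n} → (∀ i → lookup u i ≡ lookup v i) → u ≡ v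
lookup-ext {u = u} {v} eq =
  trans (sym (tabulate∘lookup u)) (trans (tabulate-cong eq) (tabulate∘lookup v))

Adj⇒Joins : {u v : Vec Bool n} → Adj (hypercube n) u v → ∃[ e ] Joins e u v
Adj⇒Joins {u = a ∷ x} {b ∷ y} (i , ≢ᵢ , unique) with a ≟ᴮ b
Adj⇒Joins {u = a ∷ x} {b ∷ y} (zero , ≢ᵢ , unique) | yes a≡b = contradiction a≡b ≢ᵢ
Adj⇒Joins {u = a ∷ x} {b ∷ y} (suc i , ≢ᵢ , unique) | yes refl
  with Adj⇒Joins {u = x} {y} (i , ≢ᵢ , λ ≢ⱼ → suc-injective (unique ≢ⱼ))
... | e , inj₁ (refl , refl) = keep a e , inj₁ (refl , refl)
... | e , inj₂ (refl , refl) = keep a e , inj₂ (refl , refl)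
-- The heads already differ, so by uniqueness a disagreement of the tails at `j` would give
-- `zero ≡ suc j`; hence the tails agree.
Adj⇒Joins {u = a ∷ x} {b ∷ y} (i , ≢ᵢ , unique) | no a≢b
  with refl ← lookup-ext {u = x} {y} (λ j → decidable-stable (lookup x j ≟ᴮ lookup y j)
         λ ≢ⱼ → contradiction (trans (sym (unique {zero} a≢b)) (unique {suc j} ≢ⱼ)) λ ())
  with a | b
... | false | true  = flip x , inj₁ (refl , refl)
... | true  | false = flip x , inj₂ (refl , refl)
... | false | false = contradiction refl a≢b
... | true  | true  = contradiction refl a≢b

-- Rooted forests

Joined : (CubeEdge n → Set) → Rel (Vec Bool n) _
Joined P u v = ∃[ e ] P e × Joins e u v

Joined-sym : {P : CubeEdge n → Set} {u v : Vec Bool n} → Joined P u v → Joined P v u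
Joined-sym (e , p , j) = e , p , Joins-sym j

Path : (CubeEdge n → Set) → Rel (Vec Bool n) _
Path P = Star (Joined P)

Path-sym : {P : CubeEdge n → Set} {u v : Vec Bool n} → Path P u v → Path P v u
Path-sym = reverse Joined-sym

edge-path : {P : CubeEdge n → Set} {e : CubeEdge n} → P e → Path P (src e) (tgt e)
edge-path p = (_ , p , inj₁ (refl , refl)) ◅ ε

-- A cut certifies that e is a bridge: removing e from P disconnects its ends.
Cut : (CubeEdge n → Set) → CubeEdge n → Set
Cut {n} P e = Σ[ s ∈ (Vec Bool n → Bool) ]
  s (src e) ≢ s (tgt e) × (∀ {e′} → P e′ → e′ ≡ e ⊎ s (src e′) ≡ s (tgt e′))

-- The root map chooses a representative of each component, isolated vertices included, so a
-- constant map expresses a spanning tree. Acyclicity is stated as every edge being a bridge,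
-- because cuts extend readily from one half of a cube to the whole.
record RootedForest (P : CubeEdge n → Set) (root : Vec Bool n → Vec Bool n) : Set where
  field
    to-root   : ∀ x → Path P x (root x)
    root-edge : ∀ {e} → P e → root (src e) ≡ root (tgt e)
    cut       : ∀ {e} → P e → Cut P e

  root-path : ∀ {u v} → Path P u v → root u ≡ root v
  root-path ε = refl
  root-path ((e , p , inj₁ (refl , refl)) ◅ w) = trans (root-edge p) (root-path w)
  root-path ((e , p , inj₂ (refl , refl)) ◅ w) = trans (sym (root-edge p)) (root-path w)

  root-idem : ∀ x → root (root x) ≡ root x
  root-idem x = sym (root-path (to-root x))

open RootedForest

-- Carries a forest assembled from smaller ones over to the colour class that consists of the same
-- edges.
RootedForest-resp : {P Q : CubeEdge n → Set} {r r′ : Vec Bool n → Vec Bool n} →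
  (∀ {e} → P e → Q e) → (∀ {e} → Q e → P e) → r ≗ r′ →
  RootedForest P r → RootedForest Q r′
RootedForest-resp P⊆Q Q⊆P r≗r′ f = record
  { to-root   = λ x → subst (Path _ x) (r≗r′ x)
                  (gmap id (λ (e , p , j) → e , P⊆Q p , j) (to-root f x))
  ; root-edge = λ q → trans (sym (r≗r′ _)) (trans (root-edge f (Q⊆P q)) (r≗r′ _))
  ; cut       = λ q → let s , sep , rest = cut f (Q⊆P q) in s , sep , rest ∘ Q⊆P
  }

reroot : {P : CubeEdge n → Set} {u : Vec Bool n} →
  RootedForest P (const u) → ∀ v → RootedForest P (const v)
reroot f v = record
  { to-root   = λ x → to-root f x ◅◅ Path-sym (to-root f v)
  ; root-edge = λ _ → refl
  ; cut       = cut f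
  }

edgeless : RootedForest {n} (const ⊥) id
edgeless = record { to-root = λ _ → ε ; root-edge = λ () ; cut = λ () }

-- Forests in the two halves of a cube: unions and gluing

keep-path : {P : CubeEdge n → Set} {Q : CubeEdge (suc n) → Set} {u v : Vec Bool n} (b : Bool) →
  (∀ {e} → P e → Q (keep b e)) → Path P u v → Path Q (b ∷ u) (b ∷ v)
keep-path b P⊆Q = gmap (b ∷_) λ where
  (e , p , inj₁ (refl , refl)) → keep b e , P⊆Q p , inj₁ (refl , refl)
  (e , p , inj₂ (refl , refl)) → keep b e , P⊆Q p , inj₂ (refl , refl)

data Union (P Q : CubeEdge n → Set) : CubeEdge (suc n) → Set where
  lower : ∀ {e} → P e → Union P Q (keep false e)
  upper : ∀ {e} → Q e → Union P Q (keep true e)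

unionRoot : (r r′ : Vec Bool n → Vec Bool n) → Vec Bool (suc n) → Vec Bool (suc n)
unionRoot r r′ (false ∷ x) = false ∷ r x
unionRoot r r′ (true  ∷ x) = true ∷ r′ x

-- No edge joins the halves, so a cut of one half extends by a constant over the other.
union : {P Q : CubeEdge n → Set} {r r′ : Vec Bool n → Vec Bool n} →
  RootedForest P r → RootedForest Q r′ → RootedForest (Union P Q) (unionRoot r r′)
union {n} {P} {Q} f g = record { to-root = to ; root-edge = const-edge ; cut = cuts }
  where
  to : ∀ x → Path (Union P Q) x _
  to (false ∷ x) = keep-path false lower (to-root f x)
  to (true  ∷ x) = keep-path true upper (to-root g x)
  const-edge : ∀ {e} → Union P Q e → _
  const-edge (lower p) = cong (false ∷_) (root-edge f p)
  const-edge (upper q) = cong (true ∷_) (root-edge g q)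
  cuts : ∀ {e} → Union P Q e → Cut (Union P Q) e
  cuts (lower p) with s , sep , rest ← cut f p =
    (λ { (false ∷ x) → s x ; (true ∷ _) → false }) , sep , λ where
      (lower p′) → Sum.map₁ (cong (keep false)) (rest p′)
      (upper _)  → inj₂ refl
  cuts (upper q) with s , sep , rest ← cut g q =
    (λ { (false ∷ _) → false ; (true ∷ x) → s x }) , sep , λ where
      (lower _)  → inj₂ refl
      (upper q′) → Sum.map₁ (cong (keep true)) (rest q′)

-- P lies in the half b, and Q with root map r hangs on it from the other half.
data Glue (b : Bool) (P Q : CubeEdge n → Set) (r : Vec Bool n → Vec Bool n) :
  CubeEdge (suc n) → Set where
  near  : ∀ {e} → P e → Glue b P Q r (keep b e)
  far   : ∀ {e} → Q e → Glue b P Q r (keep (not b) e)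
  cross : ∀ {x} → r x ≡ x → Glue b P Q r (flip x)

branch : Bool → (Vec Bool n → A) → (Vec Bool n → A) → Vec Bool (suc n) → A
branch b f g (c ∷ x) = if c xor b then g x else f x

-- The last three lemmas match the constructors of `Glue`: each gives the condition under which a
-- branched function is constant along an edge of that kind.
module Branch (b : Bool) (f g : Vec Bool n → A) where

  on-near : ∀ x → branch b f g (b ∷ x) ≡ f x
  on-near x = cong (if_then g x else f x) (xor-same b)

  on-far : ∀ x → branch b f g (not b ∷ x) ≡ g x
  on-far x = cong (if_then g x else f x) (not-xor b)
    where
    not-xor : ∀ b → not b xor b ≡ true
    not-xor false = refl
    not-xor true  = refl

  near-cong : ∀ {x y} → f x ≡ f y → branch b f g (b ∷ x) ≡ branch b f g (b ∷ y)
  near-cong eq = trans (on-near _) (trans eq (sym (on-near _)))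

  far-cong : ∀ {x y} → g x ≡ g y → branch b f g (not b ∷ x) ≡ branch b f g (not b ∷ y)
  far-cong eq = trans (on-far _) (trans eq (sym (on-far _)))

  cross-cong : ∀ {x} → f x ≡ g x → branch b f g (false ∷ x) ≡ branch b f g (true ∷ x)
  cross-cong {x} eq = go b
    where
    go : ∀ b → branch b f g (false ∷ x) ≡ branch b f g (true ∷ x)
    go false = eq
    go true  = sym eq

glueRoot : Bool → (r r′ : Vec Bool n → Vec Bool n) → Vec Bool (suc n) → Vec Bool (suc n)
glueRoot b r r′ = branch b (λ x → b ∷ r x) (λ x → b ∷ r (r′ x))

-- Each component of `Q` is attached by exactly one cross edge, the one at its root, so no cycle
-- arises and every far vertex reaches the near half through its root.
glue : ∀ b {P Q : CubeEdge n → Set} {r r′ : Vec Bool n → Vec Bool n} →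
  RootedForest P r → RootedForest Q r′ → RootedForest (Glue b P Q r′) (glueRoot b r r′)
glue {n} b {P} {Q} {r} {r′} f g = record { to-root = to b ; root-edge = const-edge ; cut = cuts }
  where
  hop : ∀ b x → r′ x ≡ x → Path (Glue b P Q r′) (not b ∷ x) (b ∷ x)
  hop false x eq = Path-sym (edge-path (cross eq))
  hop true  x eq = edge-path (cross eq)

  to-near : ∀ b x → Path (Glue b P Q r′) (b ∷ x) (b ∷ r x)
  to-near b x = keep-path b near (to-root f x)

  to-far : ∀ b x → Path (Glue b P Q r′) (not b ∷ x) (b ∷ r (r′ x))
  to-far b x = keep-path (not b) far (to-root g x)
    ◅◅ hop b (r′ x) (root-idem g x) ◅◅ to-near b (r′ x)

  to : ∀ b x → Path (Glue b P Q r′) x (glueRoot b r r′ x)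
  to false (false ∷ x) = to-near false x
  to false (true  ∷ x) = to-far false x
  to true  (false ∷ x) = to-far true x
  to true  (true  ∷ x) = to-near true x

  near-root far-root : Vec Bool n → Vec Bool (suc n)
  near-root x = b ∷ r x
  far-root x  = b ∷ r (r′ x)
  module Root = Branch b near-root far-root

  const-edge : ∀ {e} → Glue b P Q r′ e → glueRoot b r r′ (src e) ≡ glueRoot b r r′ (tgt e)
  const-edge (near p)   = Root.near-cong (cong (b ∷_) (root-edge f p))
  const-edge (far q)    = Root.far-cong (cong ((b ∷_) ∘ r) (root-edge g q))
  const-edge (cross eq) = Root.cross-cong (cong ((b ∷_) ∘ r) (sym eq))

  cuts : ∀ {e} → Glue b P Q r′ e → Cut (Glue b P Q r′) e
  -- Each far vertex takes the side of the near neighbour of its root, so no far edge and no cross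
  -- edge is cut.
  cuts (near p) with s , sep , rest ← cut f p =
    branch b s (s ∘ r′) ,
    (λ eq → sep (trans (sym (on-near _)) (trans eq (on-near _)))) , λ where
      (near p′)  → Sum.map (cong (keep b)) near-cong (rest p′)
      (far q)    → inj₂ (far-cong (cong s (root-edge g q)))
      (cross eq) → inj₂ (cross-cong (cong s (sym eq)))
    where
    open Branch b s (s ∘ r′)
  -- The cut of Q is normalised to be false at the roots of Q.
  cuts (far {e} q) with s , sep , rest ← cut g q =
    branch b (const false) t ,
    (λ eq → sep (xor-cancelʳ _ _ _ (trans (cong (λ y → s (src e) xor s y) (sym (root-edge g q)))
              (trans (sym (on-far _)) (trans eq (on-far _)))))) , λ where
      (near p)       → inj₂ (near-cong refl)
      (far q′)       → Sum.map (cong (keep (not b)))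
                         (λ eq → far-cong (cong₂ _xor_ eq (cong s (root-edge g q′)))) (rest q′)
      (cross {x} eq) → inj₂ (cross-cong
                         (sym (trans (cong (λ y → s x xor s y) eq) (xor-same (s x)))))
    where
    t : Vec Bool n → Bool
    t x = s x xor s (r′ x)
    open Branch b (const false) t
    xor-cancelʳ : ∀ a b c → a xor c ≡ b xor c → a ≡ b
    xor-cancelʳ false false c eq = refl
    xor-cancelʳ false true  false ()
    xor-cancelʳ false true  true  ()
    xor-cancelʳ true  false false ()
    xor-cancelʳ true  false true  ()
    xor-cancelʳ true  true  c eq = refl
  -- The cut separates the component of `Q` with root `x` from everything else.
  cuts (cross {x} eq) =
    branch b (const false) t , sep b , λ where
      (near p)        → inj₂ (near-cong refl)
      (far q)         → inj₂ (far-cong (cong (does ∘ (_≟ x)) (root-edge g q)))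
      (cross {y} eq′) → other y eq′
    where
    t : Vec Bool n → Bool
    t y = does (r′ y ≟ x)
    open Branch b (const false) t
    t-x : t x ≡ true
    t-x = dec-true (r′ x ≟ x) eq
    sep : ∀ b → branch b (const false) t (false ∷ x) ≢ branch b (const false) t (true ∷ x)
    sep false eq′ with () ← trans eq′ t-x
    sep true  eq′ with () ← trans (sym eq′) t-x
    other : ∀ y → r′ y ≡ y → flip y ≡ flip x ⊎
      branch b (const false) t (false ∷ y) ≡ branch b (const false) t (true ∷ y)
    other y eq′ with y ≟ x
    ... | yes y≡x = inj₁ (cong flip y≡x)
    ... | no  y≢x = inj₂ (cross-cong (sym (dec-false (r′ y ≟ x) (y≢x ∘ trans (sym eq′)))))

-- Tree decompositions with a leftover matching

module Matching (ℓ : Fin k → CubeEdge n) (κ : Vec Bool n → Fin k)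
  (κ-src : ∀ j → κ (src (ℓ j)) ≡ j) (κ-tgt : ∀ j → κ (tgt (ℓ j)) ≡ j) where

  v w : Fin k → Vec Bool n
  v = src ∘ ℓ
  w = tgt ∘ ℓ

  module _ (S : Fin k → Bool) where

    Selected : CubeEdge n → Set
    Selected e = ∃[ j ] S j ≡ true × e ≡ ℓ j

    -- The root map of the selected matching, with `w j` as the root of its edge. Since `κ` names
    -- the only candidate index for `x`, a single comparison decides whether `x` moves.
    π : Vec Bool n → Vec Bool n
    π x = if does (x ≟ v (κ x)) ∧ S (κ x) then w (κ x) else x

    π-v : ∀ {j} → S j ≡ true → π (v j) ≡ w j
    π-v {j} Sj rewrite κ-src j | dec-true (v j ≟ v j) refl | Sj = refl

    -- By `κ-tgt` the conditional yields `w j` in both branches.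
    π-w : ∀ j → π (w j) ≡ w j
    π-w j rewrite κ-tgt j with does (w j ≟ v j) ∧ S j
    ... | true  = refl
    ... | false = refl

    π-moves : ∀ {j} → S j ≡ true → π (v j) ≢ v j
    π-moves {j} Sj eq = src≢tgt (ℓ j) (trans (sym eq) (π-v Sj))

    π-moved : ∀ {x} → π x ≢ x → x ≡ v (κ x) × S (κ x) ≡ true
    π-moved {x} πx≢x with x ≟ v (κ x) | S (κ x)
    ... | yes x≡v | true  = x≡v , refl
    ... | yes _   | false = contradiction refl πx≢x
    ... | no _    | _     = contradiction refl πx≢x

    -- The tree that gets the cross edge at x when the vⱼ with S j hang on wⱼ:
    -- zero stands for the hanging tree, suc j for the one to be linked at vⱼ.
    hang : Vec Bool n → Fin (suc k)
    hang x = if does (π x ≟ x) then zero else suc (κ x)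

    hang-fixed : ∀ {x} → π x ≡ x → hang x ≡ zero
    hang-fixed {x} eq rewrite dec-true (π x ≟ x) eq = refl

    fixed-hang : ∀ {x} → hang x ≡ zero → π x ≡ x
    fixed-hang {x} eq with π x ≟ x
    ... | yes πx≡x = πx≡x

    hang-v : ∀ {j} → S j ≡ true → hang (v j) ≡ suc j
    hang-v {j} Sj rewrite dec-false (π (v j) ≟ v j) (π-moves Sj) = cong suc (κ-src j)

    v-hang : ∀ {x j} → hang x ≡ suc j → v j ≡ x × S j ≡ true
    v-hang {x} eq with π x ≟ x
    ... | no πx≢x with refl ← eq with x≡v , S-κ ← π-moved πx≢x = sym x≡v , S-κ

    matching-forest : RootedForest Selected π
    matching-forest = record
      { to-root   = to
      ; root-edge = λ { (j , Sj , refl) → trans (π-v Sj) (sym (π-w j)) }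
      ; cut       = cuts
      }
      where
      to : ∀ x → Path Selected x (π x)
      to x with π x ≟ x
      ... | yes eq = subst (Path Selected x) (sym eq) ε
      ... | no πx≢x with x≡v , S-κ ← π-moved πx≢x =
        subst₂ (Path Selected) (sym x≡v) (sym (trans (cong π x≡v) (π-v S-κ)))
          (edge-path (κ x , S-κ , refl))
      cuts : ∀ {e} → Selected e → Cut Selected e
      -- The cut isolates the single vertex `v j`; by `κ` no other selected edge meets it.
      cuts (j , Sj , refl) = s , sep , rest
        where
        s : Vec Bool n → Bool
        s y = does (y ≟ v j)
        sep : s (v j) ≢ s (w j)
        sep eq with () ← trans (sym (dec-true (v j ≟ v j) refl))
                          (trans eq (dec-false (w j ≟ v j) (src≢tgt (ℓ j) ∘ sym)))
        rest : ∀ {e} → Selected e → e ≡ ℓ j ⊎ s (src e) ≡ s (tgt e)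
        rest (i , Si , refl) with i ≟ᶠ j
        ... | yes refl = inj₁ refl
        ... | no i≢j = inj₂ (trans
          (dec-false (v i ≟ v j)
            (λ eq → i≢j (trans (sym (κ-src i)) (trans (cong κ eq) (κ-src j)))))
          (sym (dec-false (w i ≟ v j)
            (λ eq → i≢j (trans (sym (κ-tgt i)) (trans (cong κ eq) (κ-src j)))))))

-- The colour inj₁ i marks the edges of the tree i, and inj₂ j the single edge ℓ j of
-- the matching; κ witnesses that the edges ℓ j have no common ends.
record Decomposition (n k : ℕ) : Set where
  field
    colour   : CubeEdge n → Fin k ⊎ Fin k
    ℓ        : Fin k → CubeEdge n
    κ        : Vec Bool n → Fin k
    ℓ-colour : ∀ {j} → colour (ℓ j) ≡ inj₂ j
    ℓ-unique : ∀ {e j} → colour e ≡ inj₂ j → e ≡ ℓ j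
    κ-src    : ∀ j → κ (src (ℓ j)) ≡ j
    κ-tgt    : ∀ j → κ (tgt (ℓ j)) ≡ j
    root     : Vec Bool n
    tree     : ∀ i → RootedForest (λ e → colour e ≡ inj₁ i) (const root)

  open Matching ℓ κ κ-src κ-tgt public

  Tree : Fin k → CubeEdge n → Set
  Tree i e = colour e ≡ inj₁ i

  tree-at : ∀ i v → RootedForest (Tree i) (const v)
  tree-at i v = reroot (tree i) v

-- The base case: a four-cycle

square : Decomposition 2 1
square = record
  { colour   = colour
  ; ℓ        = λ _ → flip (true ∷ [])
  ; κ        = λ _ → zero
  ; ℓ-colour = λ { {zero} → refl }
  ; ℓ-unique = unique
  ; κ-src    = λ { zero → refl }
  ; κ-tgt    = λ { zero → refl }
  ; root     = false ∷ false ∷ []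
  ; tree     = λ { zero → RootedForest-resp to from roots (glue false half half) }
  }
  where
  colour : CubeEdge 2 → Fin 1 ⊎ Fin 1
  colour (flip (true ∷ []))  = inj₂ zero
  colour (flip (false ∷ [])) = inj₁ zero
  colour (keep b e)          = inj₁ zero
  unique : ∀ {e j} → colour e ≡ inj₂ j → e ≡ flip (true ∷ [])
  unique {flip (true ∷ [])} _ = refl
  unique {flip (false ∷ [])} ()
  unique {keep b e} ()
  -- `E` is the edge of `Q₁`, glued from two points and rooted at `false`. Two copies of it joined
  -- at their roots form a path of three edges, which misses just one edge of the square.
  E : CubeEdge 1 → Set
  E = Glue false (const ⊥) (const ⊥) id
  half : RootedForest E (glueRoot false id id)
  half = glue false edgeless edgeless
  T : CubeEdge 2 → Set
  T = Glue false E E (glueRoot false id id)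
  to : ∀ {e} → T e → colour e ≡ inj₁ zero
  to (near _) = refl
  to (far _)  = refl
  to (cross {false ∷ []} _) = refl
  from : ∀ {e} → colour e ≡ inj₁ zero → T e
  from {flip (false ∷ [])} _ = cross refl
  from {keep false (flip [])} _ = near (cross refl)
  from {keep true (flip [])} _ = far (cross refl)
  roots : glueRoot false (glueRoot false id id) (glueRoot false id id) ≗ const (false ∷ false ∷ [])
  roots (false ∷ false ∷ []) = refl
  roots (false ∷ true ∷ []) = refl
  roots (true ∷ false ∷ []) = refl
  roots (true ∷ true ∷ []) = refl

-- Linking trees, and the induction step

glueRoot-const : ∀ b (u v : Vec Bool n) → glueRoot b (const u) (const v) ≗ const (b ∷ u)
glueRoot-const b u v (c ∷ x) with c xor b
... | false = refl
... | true  = refl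

-- The map `const v` has `v` as its only fixed point, so the glued forest has exactly one cross
-- edge, at `v`.
link : ∀ b {P Q : CubeEdge n → Set} {u v : Vec Bool n} →
  RootedForest P (const u) → RootedForest Q (const v) →
  ∀ x → RootedForest (Glue b P Q (const v)) (const x)
link b {u = u} {v} f g = reroot (RootedForest-resp id id (glueRoot-const b u v) (glue b f g))

-- The selections for the hanging tree: `nonzero` serves copy 01, whose matching edge `ℓ zero` must
-- stay in the remainder, and `every` serves 11 and 10.
every nonzero : Fin (suc k) → Bool
every _ = true
nonzero zero    = false
nonzero (suc _) = true

module Step {n k} (D : Decomposition n (suc k)) where
  open Decomposition D

  -- The copies of Qₙ in Qₙ₊₂ = Qₙ □ C₄ are visited in the order 00, 01, 11, 10.
  copy₀ copy₁ copy₂ : Fin (suc k) ⊎ Fin (suc k) → Fin (2 + k) ⊎ Fin (2 + k)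
  copy₀ (inj₁ zero)    = inj₁ zero
  copy₀ (inj₁ (suc i)) = inj₁ (suc (suc i))
  copy₀ (inj₂ j)       = inj₂ (suc j)
  copy₁ (inj₁ i)       = inj₁ (suc i)
  copy₁ (inj₂ zero)    = inj₂ zero
  copy₁ (inj₂ (suc j)) = inj₁ zero
  copy₂ (inj₁ i)       = inj₁ (suc i)
  copy₂ (inj₂ j)       = inj₁ zero

  -- Colour `zero` is the new tree and `suc i` continues the old tree `i`, so `hang` is directly the
  -- colour of a cross edge. All edges between 00 and 10 go to `suc zero`, the one tree without
  -- edges inside 00.
  colour′ : CubeEdge (2 + n) → Fin (2 + k) ⊎ Fin (2 + k)
  colour′ (keep false (keep false e)) = copy₀ (colour e)
  colour′ (keep false (keep true e))  = copy₁ (colour e)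
  colour′ (keep true (keep true e))   = copy₂ (colour e)
  colour′ (keep true (keep false e))  = copy₂ (colour e)
  colour′ (keep false (flip x))       = inj₁ (hang nonzero x)
  colour′ (flip (true ∷ x))           = inj₁ (hang every x)
  colour′ (keep true (flip x))        = inj₁ (hang every x)
  colour′ (flip (false ∷ x))          = inj₁ (suc zero)

  copy₀-zero : ∀ {c} → copy₀ c ≡ inj₁ zero → c ≡ inj₁ zero
  copy₀-zero {inj₁ zero} _ = refl

  copy₀-suc : ∀ {c i} → copy₀ c ≡ inj₁ (suc i) → ∃[ j ] i ≡ suc j × c ≡ inj₁ (suc j)
  copy₀-suc {inj₁ (suc i)} refl = i , refl , refl

  copy₁-zero : ∀ {c} → copy₁ c ≡ inj₁ zero → ∃[ j ] nonzero j ≡ true × c ≡ inj₂ j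
  copy₁-zero {inj₂ (suc j)} _ = suc j , refl , refl

  copy₁-suc : ∀ {c i} → copy₁ c ≡ inj₁ (suc i) → c ≡ inj₁ i
  copy₁-suc {inj₁ i} refl = refl
  copy₁-suc {inj₂ zero} ()

  copy₂-zero : ∀ {c} → copy₂ c ≡ inj₁ zero → ∃[ j ] every j ≡ true × c ≡ inj₂ j
  copy₂-zero {inj₂ j} _ = j , refl , refl

  copy₂-suc : ∀ {c i} → copy₂ c ≡ inj₁ (suc i) → c ≡ inj₁ i
  copy₂-suc {inj₁ i} refl = refl

  selected : ∀ S {e} → (∃[ j ] S j ≡ true × colour e ≡ inj₂ j) → Selected S e
  selected S (j , Sj , c) = j , Sj , ℓ-unique c

  root′ : Vec Bool (2 + n)
  root′ = false ∷ false ∷ root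

  -- The far half is itself glued onto its copy 11, so all its roots lie there and the outer cross
  -- edges run between 01 and 11, never between 00 and 10.
  layered : RootedForest (λ e → colour′ e ≡ inj₁ zero) (const root′)
  layered = RootedForest-resp to from roots
    (glue false (glue false (tree zero) (matching-forest nonzero))
                (glue true (matching-forest every) (matching-forest every)))
    where
    T : CubeEdge (2 + n) → Set
    T = Glue false (Glue false (Tree zero) (Selected nonzero) (π nonzero))
                   (Glue true (Selected every) (Selected every) (π every))
                   (glueRoot true (π every) (π every))
    to : ∀ {e} → T e → colour′ e ≡ inj₁ zero
    to (near (near c)) = cong copy₀ c
    to (near (far (suc j , _ , refl))) = cong copy₁ ℓ-colour
    to (near (cross eq)) = cong inj₁ (hang-fixed nonzero eq)
    to (far (near (j , _ , refl))) = cong copy₂ ℓ-colour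
    to (far (far (j , _ , refl))) = cong copy₂ ℓ-colour
    to (far (cross eq)) = cong inj₁ (hang-fixed every eq)
    to (cross {true ∷ x} eq) = cong inj₁ (hang-fixed every (cong tail eq))
    to (cross {false ∷ x} eq) with () ← cong head eq
    from : ∀ {e} → colour′ e ≡ inj₁ zero → T e
    from {keep false (keep false e)} c = near (near (copy₀-zero c))
    from {keep false (keep true e)} c = near (far (selected nonzero (copy₁-zero c)))
    from {keep true (keep true e)} c = far (near (selected every (copy₂-zero c)))
    from {keep true (keep false e)} c = far (far (selected every (copy₂-zero c)))
    from {keep false (flip x)} c = near (cross (fixed-hang nonzero (inj₁-injective c)))
    from {keep true (flip x)} c = far (cross (fixed-hang every (inj₁-injective c)))
    from {flip (true ∷ x)} c = cross (cong (true ∷_) (fixed-hang every (inj₁-injective c)))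
    roots : _ ≗ const root′
    roots (false ∷ false ∷ x) = refl
    roots (false ∷ true ∷ x)  = refl
    roots (true ∷ false ∷ x)  = refl
    roots (true ∷ true ∷ x)   = refl

  -- The near half links 10 and 11. In the far half the vertices of 00 are isolated, so each is its
  -- own root and hangs on 10 by its own cross edge, while the tree in 01 is attached to 11 at
  -- `v zero` alone.
  rehung : RootedForest (λ e → colour′ e ≡ inj₁ (suc zero)) (const root′)
  rehung = reroot (RootedForest-resp to from roots
    (glue true (link false P P (false ∷ v zero)) (union edgeless P))) root′
    where
    P : RootedForest (Tree zero) (const (v zero))
    P = tree-at zero (v zero)
    T : CubeEdge (2 + n) → Set
    T = Glue true (Glue false (Tree zero) (Tree zero) (const (v zero)))
                  (Union (const ⊥) (Tree zero)) (unionRoot id (const (v zero)))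
    to : ∀ {e} → T e → colour′ e ≡ inj₁ (suc zero)
    to (near (near c)) = cong copy₂ c
    to (near (far c)) = cong copy₂ c
    to (near (cross refl)) = cong inj₁ (hang-v every refl)
    to (far (upper c)) = cong copy₁ c
    to (cross {false ∷ x} _) = refl
    to (cross {true ∷ x} refl) = cong inj₁ (hang-v every refl)
    from : ∀ {e} → colour′ e ≡ inj₁ (suc zero) → T e
    from {keep false (keep false e)} c with _ , () , _ ← copy₀-suc c
    from {keep false (keep true e)} c = far (upper (copy₁-suc c))
    from {keep true (keep true e)} c = near (far (copy₂-suc c))
    from {keep true (keep false e)} c = near (near (copy₂-suc c))
    -- No edge between 00 and 01 has this colour, because `nonzero zero` is `false`.
    from {keep false (flip x)} c with () ← proj₂ (v-hang nonzero (inj₁-injective c))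
    from {keep true (flip x)} c = near (cross (proj₁ (v-hang every (inj₁-injective c))))
    from {flip (true ∷ x)} c = cross (cong (true ∷_) (proj₁ (v-hang every (inj₁-injective c))))
    from {flip (false ∷ x)} c = cross refl
    roots : _ ≗ const (true ∷ false ∷ v zero)
    roots (false ∷ false ∷ x) = refl
    roots (false ∷ true ∷ x)  = refl
    roots (true ∷ false ∷ x)  = refl
    roots (true ∷ true ∷ x)   = refl

  -- Four copies of one tree are linked in the path 00, 01, 11, 10, always at `v (suc i)`. Rooting
  -- the far half at `true ∷ x` puts the middle link between 01 and 11.
  linked : ∀ i → RootedForest (λ e → colour′ e ≡ inj₁ (suc (suc i))) (const root′)
  linked i = RootedForest-resp to from (λ _ → refl)
    (link false (link false P P (true ∷ x)) (link false P P (true ∷ x)) root′)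
    where
    x : Vec Bool n
    x = v (suc i)
    P : RootedForest (Tree (suc i)) (const x)
    P = tree-at (suc i) x
    H : CubeEdge (suc n) → Set
    H = Glue false (Tree (suc i)) (Tree (suc i)) (const x)
    T : CubeEdge (2 + n) → Set
    T = Glue false H H (const (true ∷ x))
    to : ∀ {e} → T e → colour′ e ≡ inj₁ (suc (suc i))
    to (near (near c)) = cong copy₀ c
    to (near (far c)) = cong copy₁ c
    to (near (cross refl)) = cong inj₁ (hang-v nonzero refl)
    to (far (near c)) = cong copy₂ c
    to (far (far c)) = cong copy₂ c
    to (far (cross refl)) = cong inj₁ (hang-v every refl)
    to (cross refl) = cong inj₁ (hang-v every refl)
    from : ∀ {e} → colour′ e ≡ inj₁ (suc (suc i)) → T e
    from {keep false (keep false e)} c with _ , refl , c′ ← copy₀-suc c = near (near c′)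
    from {keep false (keep true e)} c = near (far (copy₁-suc c))
    from {keep true (keep true e)} c = far (far (copy₂-suc c))
    from {keep true (keep false e)} c = far (near (copy₂-suc c))
    from {keep false (flip y)} c = near (cross (proj₁ (v-hang nonzero (inj₁-injective c))))
    from {keep true (flip y)} c = far (cross (proj₁ (v-hang every (inj₁-injective c))))
    from {flip (true ∷ y)} c = cross (cong (true ∷_) (proj₁ (v-hang every (inj₁-injective c))))

  ℓ′ : Fin (2 + k) → CubeEdge (2 + n)
  ℓ′ zero    = keep false (keep true (ℓ zero))
  ℓ′ (suc j) = keep false (keep false (ℓ j))

  -- Outside 00 there is only one matching edge, so a constant suffices there.
  κ′ : Vec Bool (2 + n) → Fin (2 + k)
  κ′ (false ∷ false ∷ x) = suc (κ x)
  κ′ _                   = zero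

  copy₀-rest : ∀ {c j} → copy₀ c ≡ inj₂ j → ∃[ i ] j ≡ suc i × c ≡ inj₂ i
  copy₀-rest {inj₁ zero} ()
  copy₀-rest {inj₂ j} refl = j , refl , refl

  copy₁-rest : ∀ {c j} → copy₁ c ≡ inj₂ j → j ≡ zero × c ≡ inj₂ zero
  copy₁-rest {inj₂ zero} refl = refl , refl

  copy₂-rest : ∀ {c j} → copy₂ c ≢ inj₂ j
  copy₂-rest {inj₁ _} ()
  copy₂-rest {inj₂ _} ()

  ℓ′-unique : ∀ {e j} → colour′ e ≡ inj₂ j → e ≡ ℓ′ j
  ℓ′-unique {keep false (keep false e)} c with _ , refl , c′ ← copy₀-rest c =
    cong (keep false ∘ keep false) (ℓ-unique c′)
  ℓ′-unique {keep false (keep true e)} c with refl , c′ ← copy₁-rest c =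
    cong (keep false ∘ keep true) (ℓ-unique c′)
  ℓ′-unique {keep true (keep true e)} c = contradiction c copy₂-rest
  ℓ′-unique {keep true (keep false e)} c = contradiction c copy₂-rest
  ℓ′-unique {flip (true ∷ x)} ()
  ℓ′-unique {flip (false ∷ x)} ()

  step : Decomposition (2 + n) (2 + k)
  step = record
    { colour   = colour′
    ; ℓ        = ℓ′
    ; κ        = κ′
    ; ℓ-colour = λ { {zero} → cong copy₁ ℓ-colour ; {suc j} → cong copy₀ ℓ-colour }
    ; ℓ-unique = ℓ′-unique
    ; κ-src    = λ { zero → refl ; (suc j) → cong suc (κ-src j) }
    ; κ-tgt    = λ { zero → refl ; (suc j) → cong suc (κ-tgt j) }
    ; root     = root′
    ; tree     = λ { zero → layered ; (suc zero) → rehung ; (suc (suc i)) → linked i }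
    }

-- In this form of the dimension, `suc k` adds two by computation alone.
decomposition : ∀ k → Decomposition (2 + k * 2) (suc k)
decomposition zero    = square
decomposition (suc k) = Step.step (decomposition k)

-- Decomposing the odd cube

same-ends : {e : CubeEdge n} {u v x y : Vec Bool n} → Joins e u v → Joins e x y →
  (u ≡ x × v ≡ y) ⊎ (u ≡ y × v ≡ x)
same-ends (inj₁ (refl , refl)) (inj₁ (refl , refl)) = inj₁ (refl , refl)
same-ends (inj₁ (refl , refl)) (inj₂ (refl , refl)) = inj₂ (refl , refl)
same-ends (inj₂ (refl , refl)) (inj₁ (refl , refl)) = inj₂ (refl , refl)
same-ends (inj₂ (refl , refl)) (inj₂ (refl , refl)) = inj₁ (refl , refl)

Joins-cong : (s : Vec Bool n → A) {e : CubeEdge n} {u v : Vec Bool n} →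
  Joins e u v → s (src e) ≡ s (tgt e) → s u ≡ s v
Joins-cong s (inj₁ (refl , refl)) eq = eq
Joins-cong s (inj₂ (refl , refl)) eq = sym eq

-- The closing edge of a cycle has a cut, along which the other edges are constant.
bridged⇒forest : {P : CubeEdge n → Set} {G : Graph (Vec Bool n)} →
  (∀ {e} → P e → Cut P e) → Adj G ⇒ Joined P → IsForest G
bridged⇒forest {P = P} bridge Adj⇒Joined cycle
  with e , p , ends ← Adj⇒Joined (Cycle.close cycle)
  with s , sep , rest ← bridge p = sep (Joins-sep ends (sym (chain (s ∘ vertex) along)))
  where
  open Cycle cycle
  Joins-sep : ∀ {u v} → Joins e u v → s u ≡ s v → s (src e) ≡ s (tgt e)
  Joins-sep (inj₁ (refl , refl)) eq = eq
  Joins-sep (inj₂ (refl , refl)) eq = sym eq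

  -- No other step has the ends of the closing edge. For `zero` with the ends swapped, this rests on
  -- a cycle having at least three vertices.
  inner : ∀ (i : Fin (2 + m)) →
    ¬ ((vertex (inject₁ i) ≡ vertex (fromℕ (2 + m)) × vertex (suc i) ≡ vertex zero)
      ⊎ (vertex (inject₁ i) ≡ vertex zero × vertex (suc i) ≡ vertex (fromℕ (2 + m))))
  inner i (inj₁ (_ , eq)) with () ← distinct eq
  inner zero (inj₂ (_ , eq)) with () ← distinct eq
  inner (suc i) (inj₂ (eq , _)) with () ← distinct eq

  along : ∀ i → s (vertex (inject₁ i)) ≡ s (vertex (suc i))
  along i with e′ , p′ , ends′ ← Adj⇒Joined (step i) with rest p′
  ... | inj₁ refl = contradiction (same-ends ends′ ends) (inner i)
  ... | inj₂ eq   = Joins-cong s ends′ eq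

  chain : ∀ {l} (t : Fin (suc l) → Bool) → (∀ i → t (inject₁ i) ≡ t (suc i)) →
    t zero ≡ t (fromℕ l)
  chain {zero}  t eq = refl
  chain {suc l} t eq = trans (eq zero) (chain (t ∘ suc) (eq ∘ suc))

spanned : (CubeEdge n → Set) → Graph (Vec Bool n)
spanned {n} P = record
  { Vertex     = U
  ; Adj        = Joined P
  ; adj-sym    = Joined-sym
  ; adj-irrefl = λ eq (_ , _ , j) → adj-irrefl (hypercube n) eq (Joins⇒Adj j)
  ; adj⇒vertex = _
  }

spanned⊆cube : (P : CubeEdge n → Set) → IsSubgraph (spanned P) (hypercube n)
spanned⊆cube P = record { vertices = _ ; edges = λ (_ , _ , j) → Joins⇒Adj j }

spanning-tree : {P : CubeEdge n → Set} {u : Vec Bool n} →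
  RootedForest P (const u) → IsSpanningTree (hypercube n) (spanned P)
spanning-tree {P = P} {u} f = record
  { subgraph = spanned⊆cube P
  ; spanning = _
  ; tree     = ((u , _) , λ {x} {y} _ _ → to-root f x ◅◅ Path-sym (to-root f y))
             , bridged⇒forest (cut f) id
  }

-- The dimension is a parameter so that the result can be transported along an equation of
-- dimensions.
Splits : ℕ → ℕ → Set₁
Splits n k =
  Σ[ T ∈ (Fin k → Graph (Vec Bool n)) ]
  Σ[ R ∈ EdgeSet (hypercube n) ]
    (∀ i → IsSpanningTree (hypercube n) (T i)) ×
    IsEdgePartition (hypercube n) T R ×
    IsForest (edgeInduced R) ×
    HasComponents (edgeInduced R) k

-- Splitting two copies of a decomposed cube

module OddCube {n k} (D : Decomposition n (suc k)) where
  open Decomposition D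

  lower-half upper-half : Fin (suc k) ⊎ Fin (suc k) → Fin (suc k) ⊎ ⊤
  lower-half (inj₁ i)       = inj₁ i
  lower-half (inj₂ _)       = inj₂ tt
  upper-half (inj₁ zero)    = inj₂ tt
  upper-half (inj₁ (suc i)) = inj₁ (suc i)
  upper-half (inj₂ _)       = inj₁ zero

  -- The cross edge at `v zero` goes to the remainder, where it ties the upper copy of tree `zero`
  -- to the lower edge `ℓ zero`. Thus the upper half adds no component to those of the matching.
  crossing : Fin (2 + k) → Fin (suc k) ⊎ ⊤
  crossing zero          = inj₁ zero
  crossing (suc zero)    = inj₂ tt
  crossing (suc (suc i)) = inj₁ (suc i)

  colour′ : CubeEdge (suc n) → Fin (suc k) ⊎ ⊤
  colour′ (keep false e) = lower-half (colour e)
  colour′ (keep true e)  = upper-half (colour e)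
  colour′ (flip x)       = crossing (hang every x)

  hung : RootedForest (λ e → colour′ e ≡ inj₁ zero) (const (false ∷ root))
  hung = RootedForest-resp to from roots (glue false (tree zero) (matching-forest every))
    where
    T : CubeEdge (suc n) → Set
    T = Glue false (Tree zero) (Selected every) (π every)
    to : ∀ {e} → T e → colour′ e ≡ inj₁ zero
    to (near c) = cong lower-half c
    to (far (j , _ , refl)) = cong upper-half ℓ-colour
    to (cross eq) = cong crossing (hang-fixed every eq)
    lower-zero : ∀ {c} → lower-half c ≡ inj₁ zero → c ≡ inj₁ zero
    lower-zero {inj₁ zero} _ = refl
    upper-zero : ∀ {c} → upper-half c ≡ inj₁ zero → ∃[ j ] c ≡ inj₂ j
    upper-zero {inj₁ zero} ()
    upper-zero {inj₂ j} _ = j , refl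
    crossing-zero : ∀ {h} → crossing h ≡ inj₁ zero → h ≡ zero
    crossing-zero {zero} _ = refl
    crossing-zero {suc zero} ()
    from : ∀ {e} → colour′ e ≡ inj₁ zero → T e
    from {keep false e} c = near (lower-zero c)
    from {keep true e} c with j , c′ ← upper-zero c = far (j , refl , ℓ-unique c′)
    from {flip x} c = cross (fixed-hang every (crossing-zero c))
    roots : _ ≗ const (false ∷ root)
    roots (false ∷ x) = refl
    roots (true ∷ x)  = refl

  linked : ∀ i → RootedForest (λ e → colour′ e ≡ inj₁ (suc i)) (const (false ∷ root))
  linked i = RootedForest-resp to from (λ _ → refl)
    (link false (tree-at (suc i) (v (suc i))) (tree-at (suc i) (v (suc i))) (false ∷ root))
    where
    T : CubeEdge (suc n) → Set
    T = Glue false (Tree (suc i)) (Tree (suc i)) (const (v (suc i)))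
    to : ∀ {e} → T e → colour′ e ≡ inj₁ (suc i)
    to (near c) = cong lower-half c
    to (far c) = cong upper-half c
    to (cross refl) = cong crossing (hang-v every refl)
    lower-suc : ∀ {c} → lower-half c ≡ inj₁ (suc i) → c ≡ inj₁ (suc i)
    lower-suc {inj₁ _} refl = refl
    upper-suc : ∀ {c} → upper-half c ≡ inj₁ (suc i) → c ≡ inj₁ (suc i)
    upper-suc {inj₁ (suc _)} refl = refl
    crossing-suc : ∀ {h} → crossing h ≡ inj₁ (suc i) → h ≡ suc (suc i)
    crossing-suc {suc (suc _)} refl = refl
    crossing-suc {suc zero} ()
    from : ∀ {e} → colour′ e ≡ inj₁ (suc i) → T e
    from {keep false e} c = near (lower-suc c)
    from {keep true e} c = far (upper-suc c)
    from {flip x} c = cross (proj₁ (v-hang every (crossing-suc c)))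

  trees : ∀ i → RootedForest (λ e → colour′ e ≡ inj₁ i) (const (false ∷ root))
  trees zero    = hung
  trees (suc i) = linked i

  -- The remainder and its components

  Remaining : CubeEdge (suc n) → Set
  Remaining e = colour′ e ≡ inj₂ tt

  rootᴿ : Vec Bool (suc n) → Vec Bool (suc n)
  rootᴿ = glueRoot false (π every) (const (v zero))

  Glued : CubeEdge (suc n) → Set
  Glued = Glue false (Selected every) (Tree zero) (const (v zero))

  Remaining⇒Glued : ∀ {e} → Remaining e → Glued e
  Remaining⇒Glued {keep false e} c = near (lower-rest c)
    where
    lower-rest : ∀ {e} → lower-half (colour e) ≡ inj₂ tt → Selected every e
    lower-rest {e} c with inj₂ j ← colour e in eq = j , refl , ℓ-unique eq
  Remaining⇒Glued {keep true e} c = far (upper-rest c)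
    where
    upper-rest : ∀ {c} → upper-half c ≡ inj₂ tt → c ≡ inj₁ zero
    upper-rest {inj₁ zero} _ = refl
    upper-rest {inj₁ (suc _)} ()
  Remaining⇒Glued {flip x} c = cross (proj₁ (v-hang every (crossing-rest c)))
    where
    crossing-rest : ∀ {h} → crossing h ≡ inj₂ tt → h ≡ suc zero
    crossing-rest {suc zero} _ = refl
    crossing-rest {suc (suc _)} ()

  remaining : RootedForest Remaining rootᴿ
  remaining = RootedForest-resp to Remaining⇒Glued (λ _ → refl)
    (glue false (matching-forest every) (tree-at zero (v zero)))
    where
    to : ∀ {e} → Glued e → Remaining e
    to (near (j , _ , refl)) = cong lower-half ℓ-colour
    to (far c) = cong upper-half c
    to (cross refl) = cong crossing (hang-v every refl)

  R : EdgeSet (hypercube (suc n))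
  R = record
    { Edge     = Joined Remaining
    ; edge-sym = Joined-sym
    ; edge⇒adj = λ (_ , _ , j) → Joins⇒Adj j
    }

  -- A component is numbered by the lower matching edge that it contains.
  label : Vec Bool (suc n) → Fin (suc k)
  label x = κ (tail (rootᴿ x))

  -- A lower edge is some `ℓ j` itself; the upper tree and the cross edge are attached at `v zero`,
  -- whose root is `w zero`.
  root-src : ∀ {e} → Glued e → ∃[ j ] rootᴿ (src e) ≡ false ∷ w j
  root-src (near (j , _ , refl)) = j , cong (false ∷_) (π-v every refl)
  root-src (far _)               = zero , cong (false ∷_) (π-v every refl)
  root-src (cross refl)          = zero , cong (false ∷_) (π-v every refl)

  root-end : ∀ {x y} → Joined Remaining x y → ∃[ j ] rootᴿ x ≡ false ∷ w j
  root-end (e , c , inj₁ (refl , _)) = root-src (Remaining⇒Glued {e} c)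
  root-end (e , c , inj₂ (_ , refl)) with j , eq ← root-src (Remaining⇒Glued {e} c) =
    j , trans (sym (root-edge remaining {e} c)) eq

  -- Lower vertices off the matching are their own roots, hence the restriction to ends of remaining
  -- edges. For these the label determines the root, which makes the numbering of components
  -- injective.
  root-covered : ∀ {x y} → Joined Remaining x y → rootᴿ x ≡ false ∷ w (label x)
  root-covered xy with j , eq ← root-end xy =
    trans eq (cong (λ i → false ∷ w i) (sym (trans (cong (κ ∘ tail) eq) (κ-tgt j))))

  components : HasComponents (edgeInduced R) (suc k)
  components = record
    { to        = label ∘ proj₁
    ; cong      = λ path → cong (κ ∘ tail) (root-path remaining path)
    ; bijective = (λ {x} {y} → injective {x} {y}) , surjective
    }
    where
    injective : ∀ {x y : Σ[ x ∈ Vec Bool (suc n) ] (∃[ y ] Joined Remaining x y)} →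
      label (proj₁ x) ≡ label (proj₁ y) → Path Remaining (proj₁ x) (proj₁ y)
    injective {x , _ , jx} {y , _ , jy} eq = to-root remaining x ◅◅
      subst (λ r → Path Remaining r y)
        (trans (root-covered jy)
          (trans (cong (λ i → false ∷ w i) (sym eq)) (sym (root-covered jx))))
        (Path-sym (to-root remaining y))
    surjective : ∀ j → Σ[ x ∈ Σ[ x ∈ Vec Bool (suc n) ] (∃[ y ] Joined Remaining x y) ]
      (∀ {z : Σ[ x ∈ Vec Bool (suc n) ] (∃[ y ] Joined Remaining x y)} →
        Path Remaining (proj₁ z) (proj₁ x) → label (proj₁ z) ≡ j)
    surjective j =
      -- The witness `w j` is its own root, so its label is `j`.
      (false ∷ w j , false ∷ v j ,
        keep false (ℓ j) , cong lower-half ℓ-colour , inj₂ (refl , refl)) ,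
      λ path → trans (cong (κ ∘ tail) (root-path remaining path))
                     (trans (cong κ (π-w every j)) (κ-tgt j))

  T : Fin (suc k) → Graph (Vec Bool (suc n))
  T i = spanned (λ e → colour′ e ≡ inj₁ i)

  partition : IsEdgePartition (hypercube (suc n)) T R
  partition = record
    { subgraphs     = λ i → spanned⊆cube _
    ; covers        = covers
    ; edge-disjoint = λ i≢j (e , c , ends) (e′ , c′ , ends′) →
        i≢j (inj₁-injective (trans (sym c) (trans (cong colour′ (Joins-unique ends ends′)) c′)))
    ; rest-disjoint = λ (e , c , ends) (e′ , c′ , ends′) →
        contradiction (trans (sym c) (trans (cong colour′ (Joins-unique ends ends′)) c′)) λ ()
    }
    where
    covers : ∀ {x y} → Adj (hypercube (suc n)) x y → (∃[ i ] Adj (T i) x y) ⊎ Joined Remaining x y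
    covers adj with e , ends ← Adj⇒Joins adj with colour′ e in eq
    ... | inj₁ i = inj₁ (i , e , eq , ends)
    ... | inj₂ _ = inj₂ (e , eq , ends)

  splits : Splits (suc n) (suc k)
  splits = T , R , (λ i → spanning-tree (trees i)) , partition ,
    bridged⇒forest (cut remaining) id , components

mainTheorem4 : (k : ℕ) → k ≥ 1 →
    Σ[ T ∈ (Fin k → Graph (Vec Bool (2 * k + 1))) ]
    Σ[ R ∈ EdgeSet (hypercube (2 * k + 1)) ]
    (∀ i → IsSpanningTree (hypercube (2 * k + 1)) (T i)) ×
    IsEdgePartition (hypercube (2 * k + 1)) T R ×
    IsForest (edgeInduced R) ×
    HasComponents (edgeInduced R) k
mainTheorem4 (suc k) _ = subst (λ n → Splits n (suc k)) dimension (OddCube.splits (decomposition k))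
  where
  dimension : suc (2 + k * 2) ≡ 2 * suc k + 1
  dimension = trans (cong suc (*-comm (suc k) 2)) (+-comm 1 (2 * suc k))
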